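{- Let $P, F \subseteq \mathbb{R}^n$ be convex polyhedra, let $(V_P, C_P, R_P)$ be a generator for $P$ and let $(V_F, C_F, R_F)$ be a generator for $F$. Then the triple $$\big(V_P \oplus V_F,\; C_P \cup V_P,\; R_P \cup V_F \cup C_F \cup R_F\big)$$ is a generator for the positive post-flow of $P$ with respect to $F$, i.e., for the set $$\{\, x + \delta \cdot y \mid x \in P,\ y \in F,\ \delta > 0 \,\},$$ where $\oplus$ denotes Minkowski sum, i.e., $V_P \oplus V_F = \{ v_1 + v_2 \mid v_1 \in V_P,\ v_2 \in V_F \}$.
   Context: A convex polyhedron is a subset of $\mathbb{R}^n$ that is the intersection of a finite number of half-spaces; half-spaces may be open or closed, so convex polyhedra are not necessarily topologically closed. Generator: a triple $(V, C, R)$ of finite subsets of $\mathbb{R}^n$ (whose elements are called points, closure points and rays, respectively) is a generator for a set $S \subseteq \mathbb{R}^n$ if, for all $x \in \mathbb{R}^n$, $x \in S$ if and only if $x$ can be written as $$x = \sum_{v \in V} \alpha_v \cdot v + \sum_{c \in C} \beta_c \cdot c + \sum_{r \in R} \gamma_r \cdot r,$$ where all coefficients $\alpha_v$, $\beta_c$, $\gamma_r$ are non-negative reals, $\sum_{v \in V} \alpha_v + \sum_{c \in C} \beta_c = 1$, and there exists $v \in V$ such that $\alpha_v > 0$. It is a known fact that every convex polyhedron in $\mathbb{R}^n$ has a generator. -}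

module Defs where

open import Level using (Level; _⊔_) renaming (suc to lsuc)
open import Algebra.Apartness.Bundles using (HeytingField)
open import Algebra.Bundles using (CommutativeRing; Semiring)
import Algebra.Definitions.RawSemiring as RawSemiringDefinitions
open import Data.Fin.Base using (Fin)
open import Data.Nat.Base as ℕ using (ℕ)
open import Data.Product.Base using (∃-syntax; Σ-syntax; _×_)
open import Data.Sum.Base using (_⊎_)
open import Data.Vec.Functional using (Vector; map; zipWith; replicate)
open import Data.Vec.Functional.Relation.Binary.Pointwise using (Pointwise)
open import Function.Bundles using (_⇔_)
open import Relation.Binary.Core using (Rel)
open import Relation.Binary.Structures using (IsStrictPartialOrder)
open import Relation.Nullary.Negation using (¬_)
open import Relation.Unary using (Pred; _∈_; _≐_; ⋂)

-- The real numbers, axiomatised as a Cauchy-complete Archimedean ordered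
-- field.  Classically these axioms determine ℝ up to isomorphism.  They do not
-- include decidability of the order or of equality, so that they are also
-- the usual axioms for the constructive (Cauchy) reals.
record RealNumbers c ℓ₁ ℓ₂ ℓ₃ : Set (lsuc (c ⊔ ℓ₁ ⊔ ℓ₂ ⊔ ℓ₃)) where
  infix 4 _<_ _≤_
  field
    heytingField : HeytingField c ℓ₁ ℓ₂

  open HeytingField heytingField public

  commutativeRing : CommutativeRing c ℓ₁
  commutativeRing = record { isCommutativeRing = isCommutativeRing }

  open CommutativeRing commutativeRing public using (semiring)
  open RawSemiringDefinitions (Semiring.rawSemiring semiring) public using (sum) renaming (_×_ to _·ℕ_)

  field
    _<_                  : Rel Carrier ℓ₃
    isStrictPartialOrder : IsStrictPartialOrder _≈_ _<_
    <⇒#                  : ∀ {x y} → x < y → x # y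
    #⇒<⊎>                : ∀ {x y} → x # y → x < y ⊎ y < x
    +-monoʳ-<            : ∀ z {x y} → x < y → z + x < z + y
    *-pos                : ∀ {x y} → 0# < x → 0# < y → 0# < x * y

  _≤_ : Rel Carrier ℓ₃
  x ≤ y = ¬ (y < x)

  -- |s m - s k| < ε is s m < s k + ε together with s k < s m + ε; the second
  -- half is obtained by exchanging m and k.
  IsCauchy : (ℕ → Carrier) → Set (c ⊔ ℓ₃)
  IsCauchy s = ∀ ε → 0# < ε →
    ∃[ N ] (∀ m k → N ℕ.≤ m → N ℕ.≤ k → s m < s k + ε)

  _ConvergesTo_ : (ℕ → Carrier) → Carrier → Set (c ⊔ ℓ₃)
  s ConvergesTo l = ∀ ε → 0# < ε →
    ∃[ N ] (∀ m → N ℕ.≤ m → s m < l + ε × l < s m + ε)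

  field
    archimedean     : ∀ x → ∃[ m ] x < m ·ℕ 1#
    cauchy-complete : ∀ s → IsCauchy s → ∃[ l ] s ConvergesTo l

module Polyhedra {c ℓ₁ ℓ₂ ℓ₃} (reals : RealNumbers c ℓ₁ ℓ₂ ℓ₃) where

  open RealNumbers reals
    using (_≈_; _+_; _*_; 0#; 1#; _<_; _≤_; sum)
    renaming (Carrier to ℝ)

  private
    variable
      n : ℕ
      p q r s : Level

  infix  4 _≈ᵥ_
  infixl 6 _+ᵥ_ _⊕_
  infixr 7 _*ᵥ_

  _≈ᵥ_ : Rel (Vector ℝ n) ℓ₁
  _≈ᵥ_ = Pointwise _≈_

  0ᵥ : Vector ℝ n
  0ᵥ = replicate _ 0#

  _+ᵥ_ : Vector ℝ n → Vector ℝ n → Vector ℝ n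
  _+ᵥ_ = zipWith _+_

  _*ᵥ_ : ℝ → Vector ℝ n → Vector ℝ n
  a *ᵥ x = map (a *_) x

  ⟨_,_⟩ : Vector ℝ n → Vector ℝ n → ℝ
  ⟨ x , y ⟩ = sum (zipWith _*_ x y)

  linearCombination : ∀ {k} → Vector ℝ k → Vector (Vector ℝ n) k → Vector ℝ n
  linearCombination a v j = sum (λ i → a i * v i j)

  data HalfSpace (n : ℕ) : Set (c ⊔ ℓ₁) where
    closedHalf openHalf : (a : Vector ℝ n) → ¬ (a ≈ᵥ 0ᵥ) → ℝ → HalfSpace n

  ⟦_⟧ : HalfSpace n → Pred (Vector ℝ n) ℓ₃
  ⟦ closedHalf a _ b ⟧ x = ⟨ a , x ⟩ ≤ b
  ⟦ openHalf   a _ b ⟧ x = ⟨ a , x ⟩ < b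

  IsConvexPolyhedron : Pred (Vector ℝ n) p → Set (c ⊔ ℓ₁ ⊔ ℓ₃ ⊔ p)
  IsConvexPolyhedron {n} P =
    Σ[ m ∈ ℕ ] Σ[ H ∈ Vector (HalfSpace n) m ] P ≐ ⋂[ i ∶ Fin m ] ⟦ H i ⟧

  -- Equality of reals is undecidable, so repetitions in an enumeration cannot
  -- be excluded.  They are harmless below: splitting a coefficient over several
  -- occurrences of an element, or adding the coefficients up, changes neither
  -- the sums nor the sign conditions.
  record Enumeration (V : Pred (Vector ℝ n) p) : Set (c ⊔ ℓ₁ ⊔ p) where
    field
      size       : ℕ
      element    : Vector (Vector ℝ n) size
      enumerates : V ≐ (λ x → ∃[ i ] x ≈ᵥ element i)

  Finite : Pred (Vector ℝ n) p → Set (c ⊔ ℓ₁ ⊔ p)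
  Finite = Enumeration

  record Combination {V : Pred (Vector ℝ n) p} {C : Pred (Vector ℝ n) q}
                     {R : Pred (Vector ℝ n) r}
                     (eV : Enumeration V) (eC : Enumeration C) (eR : Enumeration R)
                     (x : Vector ℝ n) : Set (c ⊔ ℓ₁ ⊔ ℓ₃) where
    private
      module V = Enumeration eV
      module C = Enumeration eC
      module R = Enumeration eR
    field
      α             : Vector ℝ V.size
      β             : Vector ℝ C.size
      γ             : Vector ℝ R.size
      α-nonNegative : ∀ i → 0# ≤ α i
      β-nonNegative : ∀ i → 0# ≤ β i
      γ-nonNegative : ∀ i → 0# ≤ γ i
      α+β≈1         : sum α + sum β ≈ 1#
      α-positive    : ∃[ i ] 0# < α i
      decomposition : x ≈ᵥ linearCombination α V.element
                           +ᵥ linearCombination β C.element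
                           +ᵥ linearCombination γ R.element

  -- The sums over V, C and R are required to have the stated property for every
  -- enumeration, which makes this a property of the sets alone.
  record IsGenerator (V : Pred (Vector ℝ n) p) (C : Pred (Vector ℝ n) q)
                     (R : Pred (Vector ℝ n) r) (S : Pred (Vector ℝ n) s)
                     : Set (c ⊔ ℓ₁ ⊔ ℓ₃ ⊔ p ⊔ q ⊔ r ⊔ s) where
    field
      V-finite  : Finite V
      C-finite  : Finite C
      R-finite  : Finite R
      generates : (eV : Enumeration V) (eC : Enumeration C) (eR : Enumeration R) →
                  ∀ x → x ∈ S ⇔ Combination eV eC eR x

  _⊕_ : Pred (Vector ℝ n) p → Pred (Vector ℝ n) q → Pred (Vector ℝ n) (c ⊔ ℓ₁ ⊔ p ⊔ q)
  (V ⊕ W) x = ∃[ v ] ∃[ w ] v ∈ V × w ∈ W × x ≈ᵥ v +ᵥ w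

  PositivePostFlow : Pred (Vector ℝ n) p → Pred (Vector ℝ n) q →
                     Pred (Vector ℝ n) (c ⊔ ℓ₁ ⊔ ℓ₃ ⊔ p ⊔ q)
  PositivePostFlow P F z =
    ∃[ x ] ∃[ y ] ∃[ δ ] x ∈ P × y ∈ F × 0# < δ × z ≈ᵥ x +ᵥ δ *ᵥ y

{-# OPTIONS --safe #-}

-- Everything is phrased with conic combinations that remember their total
-- weight, a notion that does not depend on how the finite sets are enumerated.
-- Given x + δ y, let a > 0 be the coefficient of some v in x and b > 0 the
-- coefficient of some w in δ y.  With ε = ab/(a+b) both a − ε and b − ε are
-- positive, so ε (v + w) is a term of V_P ⊕ V_F, the rest of x consists of
-- closure points and rays of the new triple, and the rest of δ y of rays.
-- Conversely, splitting every v + w separates a combination of the new triple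
-- into an element of P and a combination of V_F, C_F, R_F in which V_F ∪ C_F
-- has some total weight δ > 0; dividing by δ gives an element of F.

module Submission where

open import Defs
open import Algebra.Bundles using (CommutativeRing)
import Algebra.Apartness.Properties.HeytingCommutativeRing as HeytingProperties
import Algebra.Properties.Semiring.Sum as SumProperties
import Algebra.Solver.Ring.NaturalCoefficients.Default as SemiringSolver
open import Data.Fin.Base using (Fin; zero; suc; splitAt; _↑ˡ_; _↑ʳ_; combine; remQuot)
open import Data.Fin.Properties using (splitAt-↑ˡ; splitAt-↑ʳ; remQuot-combine)
open import Data.Nat.Base as ℕ using (ℕ; zero; suc)
open import Data.Product.Base using (∃-syntax; _×_; _,_; proj₁; proj₂; uncurry)
open import Data.Sum.Base using (inj₁; inj₂; [_,_]′)
open import Data.Vec.Functional using (Vector; _++_)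
open import Function.Base using (_∘_; id)
open import Function.Bundles using (Equivalence; mk⇔)
open import Level using (Level; _⊔_)
open import Relation.Binary.PropositionalEquality as ≡ using (_≡_)
open import Relation.Binary.Structures using (IsStrictPartialOrder)
import Relation.Binary.Reasoning.Setoid as SetoidReasoning
open import Relation.Nullary.Negation using (contradiction)
open import Relation.Unary using (Pred; _∈_; _⊆_; _∪_)

-- Order arithmetic in the reals, with cotransitivity of apartness replacing case distinctions on
-- the order.

module OrderedField {c ℓ₁ ℓ₂ ℓ₃} (reals : RealNumbers c ℓ₁ ℓ₂ ℓ₃) where

  open RealNumbers reals hiding (zero)
  open IsStrictPartialOrder isStrictPartialOrder using (irrefl; asym; <-respˡ-≈; <-respʳ-≈)
    renaming (trans to <-trans)
  open HeytingProperties heytingCommutativeRing using (x-0≈x; invertibleˡ⇒#; #-congʳ)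
  open SemiringSolver (CommutativeRing.commutativeSemiring commutativeRing)

  <⇒≤ : ∀ {x y} → x < y → x ≤ y
  <⇒≤ = asym

  0≤0 : 0# ≤ 0#
  0≤0 = irrefl refl

  ≤-respʳ-≈ : ∀ {x y z} → y ≈ z → x ≤ y → x ≤ z
  ≤-respʳ-≈ y≈z x≤y z<x = x≤y (<-respˡ-≈ (sym y≈z) z<x)

  +-cancelˡ-< : ∀ z {x y} → z + x < z + y → x < y
  +-cancelˡ-< z zx<zy = <-respˡ-≈ (cancel _) (<-respʳ-≈ (cancel _) (+-monoʳ-< (- z) zx<zy))
    where
    cancel : ∀ x → - z + (z + x) ≈ x
    cancel x = trans (sym (+-assoc _ _ _)) (trans (+-congʳ (-‿inverseˡ z)) (+-identityˡ x))

  x<x+y⇒0<y : ∀ {x y} → x < x + y → 0# < y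
  x<x+y⇒0<y {x} x<x+y = +-cancelˡ-< x (<-respˡ-≈ (sym (+-identityʳ x)) x<x+y)

  x+y<x⇒y<0 : ∀ {x y} → x + y < x → y < 0#
  x+y<x⇒y<0 {x} x+y<x = +-cancelˡ-< x (<-respʳ-≈ (sym (+-identityʳ x)) x+y<x)

  0<y⇒x<x+y : ∀ {x y} → 0# < y → x < x + y
  0<y⇒x<x+y {x} 0<y = <-respˡ-≈ (+-identityʳ x) (+-monoʳ-< x 0<y)

  +-pos : ∀ {x y} → 0# < x → 0# < y → 0# < x + y
  +-pos 0<x 0<y = <-trans 0<x (0<y⇒x<x+y 0<y)

  0≤∧#⇒0< : ∀ {x} → 0# ≤ x → x # 0# → 0# < x
  0≤∧#⇒0< 0≤x x#0 = [ (λ x<0 → contradiction x<0 0≤x) , id ]′ (#⇒<⊎> x#0)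

  -- Since `_≤_` is a negated `_<_`, the proof refutes `x + y < 0#`. By cotransitivity `x` is apart
  -- from `x + y` or from `0#`, and each possible order then makes `x` or `y` negative.
  +-nonNeg : ∀ {x y} → 0# ≤ x → 0# ≤ y → 0# ≤ x + y
  +-nonNeg {x} {y} 0≤x 0≤y x+y<0 with #-cotrans (<⇒# x+y<0) x
  ... | inj₂ x#0 = 0≤y (x+y<x⇒y<0 (<-trans x+y<0 (0≤∧#⇒0< 0≤x x#0)))
  ... | inj₁ x+y#x with #⇒<⊎> x+y#x
  ...   | inj₁ x+y<x = 0≤y (x+y<x⇒y<0 x+y<x)
  ...   | inj₂ x<x+y = 0≤x (<-trans x<x+y x+y<0)

  -- Cotransitivity applied to `0# < x` sets `x + y` apart from one of the two ends. Apart from `0#`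
  -- it is positive, being nonnegative; apart from `x` it can only lie above `x`.
  pos+nonNeg : ∀ {x y} → 0# < x → 0# ≤ y → 0# < x + y
  pos+nonNeg {x} {y} 0<x 0≤y with #-cotrans (#-sym (<⇒# 0<x)) (x + y)
  ... | inj₂ x+y#0 = 0≤∧#⇒0< (+-nonNeg (<⇒≤ 0<x) 0≤y) x+y#0
  ... | inj₁ x#x+y with #⇒<⊎> x#x+y
  ...   | inj₁ x<x+y = <-trans 0<x x<x+y
  ...   | inj₂ x+y<x = contradiction (x+y<x⇒y<0 x+y<x) 0≤y

  -- An inverse `z` of the product makes `z * x` an inverse of `y`. Apartness corresponds to
  -- invertibility of a difference, hence the terms `- 0#`.
  factor# : ∀ x y → x * y # 0# → y # 0#
  factor# x y xy#0 with z , z*xy≈1 , _ ← #⇒invertible xy#0 = invertibleˡ⇒# (z * x , (begin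
    z * x * (y + - 0#)    ≈⟨ *-congˡ (x-0≈x y) ⟩
    z * x * y             ≈⟨ *-assoc z x y ⟩
    z * (x * y)           ≈⟨ *-congˡ (x-0≈x (x * y)) ⟨
    z * (x * y + - 0#)    ≈⟨ z*xy≈1 ⟩
    1#                    ∎))
    where open SetoidReasoning setoid

  -- A negative product is apart from zero, hence so are both factors. Being nonnegative, they are
  -- then positive, and so is their product.
  *-nonNeg : ∀ {x y} → 0# ≤ x → 0# ≤ y → 0# ≤ x * y
  *-nonNeg {x} {y} 0≤x 0≤y xy<0 = asym xy<0 (*-pos
    (0≤∧#⇒0< 0≤x (factor# y x (#-congʳ (*-comm x y) (<⇒# xy<0))))
    (0≤∧#⇒0< 0≤y (factor# x y (<⇒# xy<0))))

  square-pos : ∀ {x} → x # 0# → 0# < x * x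
  square-pos {x} x#0 with #⇒<⊎> x#0
  ... | inj₂ 0<x = *-pos 0<x 0<x
  ... | inj₁ x<0 = <-respʳ-≈ -x*-x≈x*x (*-pos 0<-x 0<-x)
    where
    open SetoidReasoning setoid
    0<-x : 0# < - x
    0<-x = x<x+y⇒0<y (<-respʳ-≈ (sym (-‿inverseʳ x)) x<0)
    -x*-x≈x*x : - x * - x ≈ x * x
    -x*-x≈x*x = begin
      - x * - x                       ≈⟨ +-identityʳ _ ⟨
      - x * - x + 0#                  ≈⟨ +-congˡ (zeroˡ x) ⟨
      - x * - x + 0# * x              ≈⟨ +-congˡ (*-congʳ (-‿inverseʳ x)) ⟨
      -- The semiring solver treats `- x` as an independent variable; the neighbouring steps supply
      -- the cancellation of `x + - x`.
      - x * - x + (x + - x) * x       ≈⟨ solve 2 (λ x y → y :* y :+ (x :+ y) :* x := (x :+ y) :* y :+ x :* x) refl x (- x) ⟩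
      (x + - x) * - x + x * x         ≈⟨ +-congʳ (*-congʳ (-‿inverseʳ x)) ⟩
      0# * - x + x * x                ≈⟨ +-congʳ (zeroˡ (- x)) ⟩
      0# + x * x                      ≈⟨ +-identityˡ _ ⟩
      x * x                           ∎

  -- The inverse `y` equals `x * (y * y)`, a product of positive numbers, because an invertible `y`
  -- is apart from zero and has a positive square.
  positiveInverse : ∀ {x} → 0# < x → ∃[ y ] 0# < y × x * y ≈ 1#
  positiveInverse {x} 0<x with y , y*[x-0]≈1 , _ ← #⇒invertible (#-sym (<⇒# 0<x)) =
    y , <-respʳ-≈ x*y²≈y (*-pos 0<x (square-pos y#0)) , x*y≈1
    where
    x*y≈1 : x * y ≈ 1#
    x*y≈1 = trans (*-comm x y) (trans (*-congˡ (sym (x-0≈x x))) y*[x-0]≈1)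
    y#0 : y # 0#
    y#0 = invertibleˡ⇒# (x , trans (*-congˡ (x-0≈x y)) x*y≈1)
    x*y²≈y : x * (y * y) ≈ y
    x*y²≈y = trans (sym (*-assoc x y y)) (trans (*-congʳ x*y≈1) (*-identityˡ y))

  -- With `u` the inverse of `a + b`, the remainders are `a * a * u` and `b * b * u`. These formulas
  -- avoid deciding which of `a` and `b` is smaller.
  commonPositivePart : ∀ {a b} → 0# < a → 0# < b →
    ∃[ ε ] ∃[ a′ ] ∃[ b′ ] 0# < ε × 0# < a′ × 0# < b′ × a ≈ ε + a′ × b ≈ ε + b′
  commonPositivePart {a} {b} 0<a 0<b with u , 0<u , [a+b]*u≈1 ← positiveInverse (+-pos 0<a 0<b) =
    a * b * u , a * a * u , b * b * u ,
    *-pos (*-pos 0<a 0<b) 0<u , *-pos (*-pos 0<a 0<a) 0<u , *-pos (*-pos 0<b 0<b) 0<u ,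
    trans (expand a) (solve 3 (λ a b u → a :* ((a :+ b) :* u) := a :* b :* u :+ a :* a :* u) refl a b u) ,
    trans (expand b) (solve 3 (λ a b u → b :* ((a :+ b) :* u) := a :* b :* u :+ b :* b :* u) refl a b u)
    where
    expand : ∀ x → x ≈ x * ((a + b) * u)
    expand x = trans (sym (*-identityʳ x)) (*-congˡ (sym [a+b]*u≈1))

-- Weighted conic combinations over a set.

module Cones {c ℓ₁ ℓ₂ ℓ₃} (reals : RealNumbers c ℓ₁ ℓ₂ ℓ₃) where

  open RealNumbers reals hiding (zero) renaming (Carrier to ℝ)
  open IsStrictPartialOrder isStrictPartialOrder using (<-respʳ-≈)
  open Polyhedra reals
  open OrderedField reals
  open SumProperties semiring using (∑-distrib-+; sum-cong-≋; sum-replicate-zero)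
  open SemiringSolver (CommutativeRing.commutativeSemiring commutativeRing)
  open SetoidReasoning setoid

  private
    variable
      n k : ℕ
      p q r : Level
      V W C R : Pred (Vector ℝ n) p
      a s t : ℝ
      x y : Vector ℝ n

  -- The real index is the sum of the coefficients. Closure rules in place of coefficient vectors
  -- turn later arguments into inductions free of indices; `resp` is a rule because `_≈_` is a
  -- setoid equality.
  data Cone (V : Pred (Vector ℝ n) p) : ℝ → Vector ℝ n → Set (c ⊔ ℓ₁ ⊔ ℓ₃ ⊔ p) where
    origin : Cone V 0# 0ᵥ
    ray    : ∀ {a v} → 0# ≤ a → v ∈ V → Cone V a (a *ᵥ v)
    _⊹_    : ∀ {s t x y} → Cone V s x → Cone V t y → Cone V (s + t) (x +ᵥ y)
    resp   : ∀ {s t x y} → s ≈ t → x ≈ᵥ y → Cone V s x → Cone V t y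

  infixl 6 _⊹_

  -- The condition that some coefficient is positive, encoded by setting one such term apart from
  -- `rest`, where it is ready to be split.
  record StrictCone (V : Pred (Vector ℝ n) p) (s : ℝ) (x : Vector ℝ n)
                    : Set (c ⊔ ℓ₁ ⊔ ℓ₃ ⊔ p) where
    field
      {coefficient restWeight} : ℝ
      {point restValue}        : Vector ℝ n
      positive                 : 0# < coefficient
      point∈                   : point ∈ V
      rest                     : Cone V restWeight restValue
      weight                   : s ≈ coefficient + restWeight
      value                    : x ≈ᵥ coefficient *ᵥ point +ᵥ restValue

  -- The counterpart of `Combination` without enumerations; the weight `s₃` of the rays is left
  -- free.
  record ConicDecomposition (V : Pred (Vector ℝ n) p) (C : Pred (Vector ℝ n) q)
                            (R : Pred (Vector ℝ n) r) (x : Vector ℝ n)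
                            : Set (c ⊔ ℓ₁ ⊔ ℓ₃ ⊔ p ⊔ q ⊔ r) where
    field
      {s₁ s₂ s₃}    : ℝ
      {x₁ x₂ x₃}    : Vector ℝ n
      points        : StrictCone V s₁ x₁
      closurePoints : Cone C s₂ x₂
      rays          : Cone R s₃ x₃
      s₁+s₂≈1       : s₁ + s₂ ≈ 1#
      value         : x ≈ᵥ x₁ +ᵥ x₂ +ᵥ x₃

  weight-nonNeg : Cone V s x → 0# ≤ s
  weight-nonNeg origin           = 0≤0
  weight-nonNeg (ray 0≤a _)      = 0≤a
  weight-nonNeg (X ⊹ Y)          = +-nonNeg (weight-nonNeg X) (weight-nonNeg Y)
  weight-nonNeg (resp s≈t _ X)   = ≤-respʳ-≈ s≈t (weight-nonNeg X)

  weight-pos : StrictCone V s x → 0# < s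
  weight-pos X = <-respʳ-≈ (sym weight) (pos+nonNeg positive (weight-nonNeg rest))
    where open StrictCone X

  mono : V ⊆ W → Cone V s x → Cone W s x
  mono V⊆W origin             = origin
  mono V⊆W (ray 0≤a v∈V)      = ray 0≤a (V⊆W v∈V)
  mono V⊆W (X ⊹ Y)            = mono V⊆W X ⊹ mono V⊆W Y
  mono V⊆W (resp s≈t x≈y X)   = resp s≈t x≈y (mono V⊆W X)

  scale : 0# ≤ a → Cone V s x → Cone V (a * s) (a *ᵥ x)
  scale 0≤a origin             = resp (sym (zeroʳ _)) (λ _ → sym (zeroʳ _)) origin
  scale 0≤a (ray 0≤b v∈V)      = resp refl (λ _ → *-assoc _ _ _) (ray (*-nonNeg 0≤a 0≤b) v∈V)
  scale 0≤a (X ⊹ Y)            =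
    resp (sym (distribˡ _ _ _)) (λ _ → sym (distribˡ _ _ _)) (scale 0≤a X ⊹ scale 0≤a Y)
  scale 0≤a (resp s≈t x≈y X)   = resp (*-congˡ s≈t) (λ j → *-congˡ (x≈y j)) (scale 0≤a X)

  scale⁺ : 0# < a → StrictCone V s x → StrictCone V (a * s) (a *ᵥ x)
  scale⁺ 0<a X = record
    { positive = *-pos 0<a positive
    ; point∈   = point∈
    ; rest     = scale (<⇒≤ 0<a) rest
    ; weight   = trans (*-congˡ weight) (distribˡ _ _ _)
    ; value    = λ j → trans (*-congˡ (value j))
                         (trans (distribˡ _ _ _) (+-congʳ (sym (*-assoc _ _ _))))
    }
    where open StrictCone X

  infixl 6 _⁺⊹_

  _⁺⊹_ : StrictCone V s x → Cone V t y → StrictCone V (s + t) (x +ᵥ y)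
  X ⁺⊹ Y = record
    { positive = positive
    ; point∈   = point∈
    ; rest     = rest ⊹ Y
    ; weight   = trans (+-congʳ weight) (+-assoc _ _ _)
    ; value    = λ j → trans (+-congʳ (value j)) (+-assoc _ _ _)
    }
    where open StrictCone X

  -- Splitting combinations over unions and Minkowski sums.

  +-interchange : ∀ a b c d → (a + b) + (c + d) ≈ (a + c) + (b + d)
  +-interchange = solve 4 (λ a b c d → (a :+ b) :+ (c :+ d) := (a :+ c) :+ (b :+ d)) refl

  split-∪ : Cone (V ∪ W) s x → ∃[ s₁ ] ∃[ s₂ ] ∃[ x₁ ] ∃[ x₂ ]
            Cone V s₁ x₁ × Cone W s₂ x₂ × s ≈ s₁ + s₂ × x ≈ᵥ x₁ +ᵥ x₂
  split-∪ origin = _ , _ , _ , _ , origin , origin , sym (+-identityʳ _) , λ _ → sym (+-identityʳ _)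
  split-∪ (ray 0≤a (inj₁ v∈V)) =
    _ , _ , _ , _ , ray 0≤a v∈V , origin , sym (+-identityʳ _) , λ _ → sym (+-identityʳ _)
  split-∪ (ray 0≤a (inj₂ v∈W)) =
    _ , _ , _ , _ , origin , ray 0≤a v∈W , sym (+-identityˡ _) , λ _ → sym (+-identityˡ _)
  split-∪ (X ⊹ Y)
    with _ , _ , _ , _ , X₁ , X₂ , s≈ , x≈ ← split-∪ X
       | _ , _ , _ , _ , Y₁ , Y₂ , t≈ , y≈ ← split-∪ Y =
    _ , _ , _ , _ , X₁ ⊹ Y₁ , X₂ ⊹ Y₂ ,
    trans (+-cong s≈ t≈) (+-interchange _ _ _ _) ,
    λ j → trans (+-cong (x≈ j) (y≈ j)) (+-interchange _ _ _ _)
  split-∪ (resp s≈t x≈y X) with _ , _ , _ , _ , X₁ , X₂ , s≈ , x≈ ← split-∪ X =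
    _ , _ , _ , _ , X₁ , X₂ , trans (sym s≈t) s≈ , λ j → trans (sym (x≈y j)) (x≈ j)

  -- A term `a (v + w)` becomes `a v` and `a w`, so both parts keep the full weight `s`.
  split-⊕ : Cone (V ⊕ W) s x → ∃[ x₁ ] ∃[ x₂ ] Cone V s x₁ × Cone W s x₂ × x ≈ᵥ x₁ +ᵥ x₂
  split-⊕ origin = _ , _ , origin , origin , λ _ → sym (+-identityʳ _)
  split-⊕ (ray 0≤a (_ , _ , v∈V , w∈W , x≈v+w)) =
    _ , _ , ray 0≤a v∈V , ray 0≤a w∈W , λ j → trans (*-congˡ (x≈v+w j)) (distribˡ _ _ _)
  split-⊕ (X ⊹ Y)
    with _ , _ , X₁ , X₂ , x≈ ← split-⊕ X
       | _ , _ , Y₁ , Y₂ , y≈ ← split-⊕ Y =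
    _ , _ , X₁ ⊹ Y₁ , X₂ ⊹ Y₂ , λ j → trans (+-cong (x≈ j) (y≈ j)) (+-interchange _ _ _ _)
  split-⊕ (resp s≈t x≈y X) with _ , _ , X₁ , X₂ , x≈ ← split-⊕ X =
    _ , _ , resp s≈t (λ _ → refl) X₁ , resp s≈t (λ _ → refl) X₂ , λ j → trans (sym (x≈y j)) (x≈ j)

  split-⊕⁺ : StrictCone (V ⊕ W) s x →
             ∃[ x₁ ] ∃[ x₂ ] StrictCone V s x₁ × StrictCone W s x₂ × x ≈ᵥ x₁ +ᵥ x₂
  split-⊕⁺ X with v , w , v∈V , w∈W , x≈v+w ← StrictCone.point∈ X
                | _ , _ , X₁ , X₂ , rest≈ ← split-⊕ (StrictCone.rest X) =
    _ , _ , part v∈V X₁ , part w∈W X₂ , λ j → begin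
      _  ≈⟨ value j ⟩
      _  ≈⟨ +-cong (trans (*-congˡ (x≈v+w j)) (distribˡ _ _ _)) (rest≈ j) ⟩
      _  ≈⟨ +-interchange _ _ _ _ ⟩
      _  ∎
    where
    open StrictCone X
    part : ∀ {p} {U : Pred (Vector ℝ _) p} {u y} → u ∈ U → Cone U restWeight y →
           StrictCone U _ (coefficient *ᵥ u +ᵥ y)
    part u∈U Y = record
      { positive = positive ; point∈ = u∈U ; rest = Y ; weight = weight ; value = λ _ → refl }

  -- Passage between conic combinations and coefficient vectors.

  fromCoefficients : (e : Vector (Vector ℝ n) k) (α : Vector ℝ k) →
                     (∀ i → e i ∈ V) → (∀ i → 0# ≤ α i) →
                     Cone V (sum α) (linearCombination α e)
  fromCoefficients {k = zero}  e α e∈V 0≤α = origin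
  fromCoefficients {k = suc k} e α e∈V 0≤α =
    ray (0≤α zero) (e∈V zero) ⊹ fromCoefficients (e ∘ suc) (α ∘ suc) (e∈V ∘ suc) (0≤α ∘ suc)

  -- Induction on the position of the positive coefficient; the terms before it move into `rest`.
  fromCoefficients⁺ : (e : Vector (Vector ℝ n) k) (α : Vector ℝ k) →
                      (∀ i → e i ∈ V) → (∀ i → 0# ≤ α i) → ∀ i → 0# < α i →
                      StrictCone V (sum α) (linearCombination α e)
  fromCoefficients⁺ e α e∈V 0≤α zero 0<αᵢ = record
    { positive = 0<αᵢ
    ; point∈   = e∈V zero
    ; rest     = fromCoefficients (e ∘ suc) (α ∘ suc) (e∈V ∘ suc) (0≤α ∘ suc)
    ; weight   = refl
    ; value    = λ _ → refl
    }
  fromCoefficients⁺ {V = V} e α e∈V 0≤α (suc i) 0<αᵢ = record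
    { positive = positive
    ; point∈   = point∈
    ; rest     = ray (0≤α zero) (e∈V zero) ⊹ rest
    ; weight   = trans (+-congˡ weight) (x+[y+z]≈y+[x+z] _ _ _)
    ; value    = λ j → trans (+-congˡ (value j)) (x+[y+z]≈y+[x+z] _ _ _)
    }
    where
    open StrictCone (fromCoefficients⁺ {V = V} (e ∘ suc) (α ∘ suc) (e∈V ∘ suc) (0≤α ∘ suc) i 0<αᵢ)
    x+[y+z]≈y+[x+z] : ∀ x y z → x + (y + z) ≈ y + (x + z)
    x+[y+z]≈y+[x+z] = solve 3 (λ x y z → x :+ (y :+ z) := y :+ (x :+ z)) refl

  single : Fin k → ℝ → Vector ℝ k
  single zero    a zero    = a
  single zero    a (suc i) = 0#
  single (suc j) a zero    = 0#
  single (suc j) a (suc i) = single j a i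

  single-nonNeg : ∀ j → 0# ≤ a → (i : Fin k) → 0# ≤ single j a i
  single-nonNeg zero    0≤a zero    = 0≤a
  single-nonNeg zero    0≤a (suc i) = 0≤0
  single-nonNeg (suc j) 0≤a zero    = 0≤0
  single-nonNeg (suc j) 0≤a (suc i) = single-nonNeg j 0≤a i

  single-self : ∀ (j : Fin k) a → single j a j ≡ a
  single-self zero    a = ≡.refl
  single-self (suc j) a = single-self j a

  sum-single : ∀ (j : Fin k) a → sum (single j a) ≈ a
  sum-single {suc k} zero    a = trans (+-congˡ (sum-replicate-zero k)) (+-identityʳ a)
  sum-single {suc k} (suc j) a = trans (+-identityˡ _) (sum-single j a)

  sum-single-* : ∀ (j : Fin k) a (f : Vector ℝ k) → sum (λ i → single j a i * f i) ≈ a * f j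
  sum-single-* {suc k} zero a f = begin
    a * f zero + sum (λ i → 0# * f (suc i))  ≈⟨ +-congˡ (sum-cong-≋ (λ i → zeroˡ (f (suc i)))) ⟩
    a * f zero + sum {k} (λ _ → 0#)          ≈⟨ +-congˡ (sum-replicate-zero k) ⟩
    a * f zero + 0#                          ≈⟨ +-identityʳ _ ⟩
    a * f zero                               ∎
  sum-single-* {suc k} (suc j) a f = begin
    0# * f zero + sum (λ i → single j a i * f (suc i))  ≈⟨ +-cong (zeroˡ _) (sum-single-* j a (f ∘ suc)) ⟩
    0# + a * f (suc j)                                  ≈⟨ +-identityˡ _ ⟩
    a * f (suc j)                                       ∎

  record Coefficients (e : Vector (Vector ℝ n) k) (s : ℝ) (x : Vector ℝ n)
                      : Set (c ⊔ ℓ₁ ⊔ ℓ₃) where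
    field
      coefficients : Vector ℝ k
      nonNegative  : ∀ i → 0# ≤ coefficients i
      weight       : sum coefficients ≈ s
      value        : linearCombination coefficients e ≈ᵥ x

  addCoefficients : {e : Vector (Vector ℝ n) k} →
                    Coefficients e s x → Coefficients e t y → Coefficients e (s + t) (x +ᵥ y)
  addCoefficients {e = e} X Y = record
    { coefficients = λ i → X.coefficients i + Y.coefficients i
    ; nonNegative  = λ i → +-nonNeg (X.nonNegative i) (Y.nonNegative i)
    ; weight       = trans (∑-distrib-+ X.coefficients Y.coefficients) (+-cong X.weight Y.weight)
    ; value        = λ j → begin
        sum (λ i → (X.coefficients i + Y.coefficients i) * e i j)
          ≈⟨ sum-cong-≋ (λ i → distribʳ (e i j) (X.coefficients i) (Y.coefficients i)) ⟩
        sum (λ i → X.coefficients i * e i j + Y.coefficients i * e i j)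
          ≈⟨ ∑-distrib-+ (λ i → X.coefficients i * e i j) (λ i → Y.coefficients i * e i j) ⟩
        linearCombination X.coefficients e j + linearCombination Y.coefficients e j
          ≈⟨ +-cong (X.value j) (Y.value j) ⟩
        _ ∎
    }
    where
    module X = Coefficients X
    module Y = Coefficients Y

  singleCoefficient : {e : Vector (Vector ℝ n) k} → 0# ≤ a → ∀ i → x ≈ᵥ e i →
                      Coefficients e a (a *ᵥ x)
  singleCoefficient {a = a} {e = e} 0≤a i x≈eᵢ = record
    { coefficients = single i a
    ; nonNegative  = single-nonNeg i 0≤a
    ; weight       = sum-single i a
    ; value        = λ j → trans (sum-single-* i a (λ i → e i j)) (*-congˡ (sym (x≈eᵢ j)))
    }

  -- The membership proof in each `ray` supplies an index of the enumeration, so no equality of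
  -- vectors has to be decided. Terms that meet at one index are added up.
  toCoefficients : (eV : Enumeration V) → Cone V s x → Coefficients (Enumeration.element eV) s x
  toCoefficients eV origin = record
    { coefficients = λ _ → 0#
    ; nonNegative  = λ _ → 0≤0
    ; weight       = sum-replicate-zero size
    ; value        = λ j → trans (sum-cong-≋ (λ i → zeroˡ (element i j))) (sum-replicate-zero size)
    }
    where open Enumeration eV
  toCoefficients eV (ray 0≤a v∈V) =
    uncurry (singleCoefficient 0≤a) (proj₁ (Enumeration.enumerates eV) v∈V)
  toCoefficients eV (X ⊹ Y) = addCoefficients (toCoefficients eV X) (toCoefficients eV Y)
  toCoefficients eV (resp s≈t x≈y X) = record
    { coefficients = coefficients
    ; nonNegative  = nonNegative
    ; weight       = trans weight s≈t
    ; value        = λ j → trans (value j) (x≈y j)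
    }
    where open Coefficients (toCoefficients eV X)

  toCoefficients⁺ : (eV : Enumeration V) → StrictCone V s x →
                    ∃[ X ] ∃[ i ] 0# < Coefficients.coefficients {e = Enumeration.element eV} {s} {x} X i
  toCoefficients⁺ eV X
    with i , v≈eᵢ ← proj₁ (Enumeration.enumerates eV) (StrictCone.point∈ X) =
    record
      { coefficients = coefficients
      ; nonNegative  = nonNegative
      ; weight       = trans weight (sym X.weight)
      ; value        = λ j → trans (value j) (sym (X.value j))
      } ,
    -- The coefficient at `i` is the positive one set apart plus a nonnegative contribution of
    -- `rest`.
    i , pos+nonNeg (≡.subst (0# <_) (≡.sym (single-self i _)) X.positive)
                   (Coefficients.nonNegative (toCoefficients eV X.rest) i)
    where
    module X = StrictCone X
    open Coefficients (addCoefficients (singleCoefficient (<⇒≤ X.positive) i v≈eᵢ)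
                                       (toCoefficients eV X.rest))

  element∈ : (eV : Enumeration V) → ∀ i → Enumeration.element eV i ∈ V
  element∈ eV i = proj₂ (Enumeration.enumerates eV) (i , λ _ → refl)

  decompose : (eV : Enumeration V) (eC : Enumeration C) (eR : Enumeration R) →
              Combination eV eC eR x → ConicDecomposition V C R x
  decompose eV eC eR X = record
    { points        = uncurry (fromCoefficients⁺ _ α (element∈ eV) α-nonNegative) α-positive
    ; closurePoints = fromCoefficients _ β (element∈ eC) β-nonNegative
    ; rays          = fromCoefficients _ γ (element∈ eR) γ-nonNegative
    ; s₁+s₂≈1       = α+β≈1
    ; value         = decomposition
    }
    where open Combination X

  recompose : (eV : Enumeration V) (eC : Enumeration C) (eR : Enumeration R) →
              ConicDecomposition V C R x → Combination eV eC eR x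
  recompose eV eC eR X with A , i , 0<αᵢ ← toCoefficients⁺ eV (ConicDecomposition.points X) = record
    { α             = A.coefficients
    ; β             = B.coefficients
    ; γ             = Γ.coefficients
    ; α-nonNegative = A.nonNegative
    ; β-nonNegative = B.nonNegative
    ; γ-nonNegative = Γ.nonNegative
    ; α+β≈1         = trans (+-cong A.weight B.weight) s₁+s₂≈1
    ; α-positive    = i , 0<αᵢ
    ; decomposition = λ j → trans (value j)
        (sym (+-cong (+-cong (A.value j) (B.value j)) (Γ.value j)))
    }
    where
    open ConicDecomposition X
    module A = Coefficients A
    module B = Coefficients (toCoefficients eC closurePoints)
    module Γ = Coefficients (toCoefficients eR rays)

  -- Finiteness of unions and Minkowski sums.

  ∪-enumeration : Enumeration V → Enumeration W → Enumeration (V ∪ W)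
  ∪-enumeration {V = V} {W = W} eV eW = record
    { size       = V.size ℕ.+ W.size
    ; element    = V.element ++ W.element
    ; enumerates = to , from
    }
    where
    module V = Enumeration eV
    module W = Enumeration eW
    Listed : Pred (Vector ℝ _) _
    Listed x = ∃[ i ] x ≈ᵥ (V.element ++ W.element) i
    to : V ∪ W ⊆ Listed
    to {x} (inj₁ x∈V) with i , x≈ ← proj₁ V.enumerates x∈V =
      i ↑ˡ W.size , ≡.subst (λ k → x ≈ᵥ [ V.element , W.element ]′ k) (≡.sym (splitAt-↑ˡ V.size i W.size)) x≈
    to {x} (inj₂ x∈W) with i , x≈ ← proj₁ W.enumerates x∈W =
      V.size ↑ʳ i , ≡.subst (λ k → x ≈ᵥ [ V.element , W.element ]′ k) (≡.sym (splitAt-↑ʳ V.size W.size i)) x≈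
    from : Listed ⊆ V ∪ W
    from (i , x≈) with splitAt V.size i
    ... | inj₁ j = inj₁ (proj₂ V.enumerates (j , x≈))
    ... | inj₂ j = inj₂ (proj₂ W.enumerates (j , x≈))

  ⊕-enumeration : Enumeration V → Enumeration W → Enumeration (V ⊕ W)
  ⊕-enumeration {V = V} {W = W} eV eW = record
    { size       = V.size ℕ.* W.size
    ; element    = pairSum ∘ remQuot W.size
    ; enumerates = to , from
    }
    where
    module V = Enumeration eV
    module W = Enumeration eW
    pairSum : Fin V.size × Fin W.size → Vector ℝ _
    pairSum (i , j) = V.element i +ᵥ W.element j
    Listed : Pred (Vector ℝ _) _
    Listed x = ∃[ i ] x ≈ᵥ pairSum (remQuot W.size i)
    to : V ⊕ W ⊆ Listed
    to {x} (v , w , v∈V , w∈W , x≈v+w)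
      with i , v≈ ← proj₁ V.enumerates v∈V | j , w≈ ← proj₁ W.enumerates w∈W =
      combine i j , ≡.subst (λ ij → x ≈ᵥ pairSum ij) (≡.sym (remQuot-combine i j))
        (λ l → trans (x≈v+w l) (+-cong (v≈ l) (w≈ l)))
    from : Listed ⊆ V ⊕ W
    from (i , x≈) = _ , _ , element∈ eV _ , element∈ eW _ , x≈

  -- Generators restated through conic decompositions.

  module _ {S : Pred (Vector ℝ n) q} (gen : IsGenerator V C R S) where

    open IsGenerator gen

    -- The enumerations bundled with the generator are used here. The resulting decomposition does
    -- not mention them, so it can be written out over any others.
    ∈⇒conic : x ∈ S → ConicDecomposition V C R x
    ∈⇒conic x∈S = decompose _ _ _ (Equivalence.to (generates V-finite C-finite R-finite _) x∈S)

    conic⇒∈ : ConicDecomposition V C R x → x ∈ S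
    conic⇒∈ X = Equivalence.from (generates V-finite C-finite R-finite _) (recompose _ _ _ X)

-- The two inclusions, on the level of conic decompositions.

module PostFlow {c ℓ₁ ℓ₂ ℓ₃} (reals : RealNumbers c ℓ₁ ℓ₂ ℓ₃) where

  open RealNumbers reals hiding (zero) renaming (Carrier to ℝ)
  open Polyhedra reals
  open OrderedField reals
  open Cones reals
  open SemiringSolver (CommutativeRing.commutativeSemiring commutativeRing)
  open SetoidReasoning setoid

  private
    variable
      n : ℕ
      p : Level
      V-P C-P R-P V-F C-F R-F : Pred (Vector ℝ n) p
      x y z : Vector ℝ n
      δ : ℝ

  flow : ConicDecomposition V-P C-P R-P x → ConicDecomposition V-F C-F R-F y → 0# < δ →
         z ≈ᵥ x +ᵥ δ *ᵥ y →
         ConicDecomposition (V-P ⊕ V-F) (C-P ∪ V-P) (R-P ∪ V-F ∪ C-F ∪ R-F) z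
  flow {δ = δ} X Y 0<δ z≈x+δy
    -- `ε` is cut from the coefficient of the positive term of `x` and from that of `δ *ᵥ y`, which
    -- is `δ` times the one in `y`.
    with ε , a , b , 0<ε , 0<a , 0<b , v≈ε+a , w≈ε+b
           ← commonPositivePart (StrictCone.positive (ConicDecomposition.points X))
                                (*-pos 0<δ (StrictCone.positive (ConicDecomposition.points Y))) = record
    { points        = record
        { positive = 0<ε
        ; point∈   = _ , _ , X.point∈ , Y.point∈ , λ _ → refl
        ; rest     = origin
        ; weight   = sym (+-identityʳ ε)
        ; value    = λ _ → sym (+-identityʳ _)
        }
    -- `V-P` is part of the new closure points, so what remains of the points of `x` still counts
    -- towards the total weight 1.
    ; closurePoints = mono inj₂ (ray (<⇒≤ 0<a) X.point∈ ⊹ X.rest) ⊹ mono inj₁ X.closurePoints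
    ; rays          = mono inj₁ X.rays
                    -- Rays carry no weight condition, so all that remains of `δ *ᵥ y` fits among
                    -- them.
                    ⊹ mono (inj₂ ∘ inj₁) (ray (<⇒≤ 0<b) Y.point∈ ⊹ scale 0≤δ Y.rest)
                    ⊹ mono (inj₂ ∘ inj₂ ∘ inj₁) (scale 0≤δ Y.closurePoints)
                    ⊹ mono (inj₂ ∘ inj₂ ∘ inj₂) (scale 0≤δ Y.rays)
    ; s₁+s₂≈1       = begin
        ε + (a + X.restWeight + X.s₂)
          ≈⟨ solve 4 (λ ε a s t → ε :+ (a :+ s :+ t) := ε :+ a :+ s :+ t) refl ε a X.restWeight X.s₂ ⟩
        ε + a + X.restWeight + X.s₂
          ≈⟨ +-congʳ (+-congʳ v≈ε+a) ⟨
        X.coefficient + X.restWeight + X.s₂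
          ≈⟨ +-congʳ X.weight ⟨
        X.s₁ + X.s₂
          ≈⟨ X.s₁+s₂≈1 ⟩
        1# ∎
    ; value         = λ j → begin
        _ ≈⟨ z≈x+δy j ⟩
        _ ≈⟨ +-cong (X.value j) (*-congˡ (Y.value j)) ⟩
        _ ≈⟨ +-cong (+-congʳ (+-congʳ (X.pointValue j))) (*-congˡ (+-congʳ (+-congʳ (Y.pointValue j)))) ⟩
        X.coefficient * X.point j + X.restValue j + X.x₂ j + X.x₃ j
          + δ * (Y.coefficient * Y.point j + Y.restValue j + Y.x₂ j + Y.x₃ j)
          -- Distributing `δ` exposes `δ * Y.coefficient`, which is then replaced by `ε + b`.
          ≈⟨ +-congˡ (solve 6 (λ δ b w y c r → δ :* (b :* w :+ y :+ c :+ r)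
                                 := δ :* b :* w :+ δ :* y :+ δ :* c :+ δ :* r) refl
                       δ Y.coefficient (Y.point j) (Y.restValue j) (Y.x₂ j) (Y.x₃ j)) ⟩
        X.coefficient * X.point j + X.restValue j + X.x₂ j + X.x₃ j
          + (δ * Y.coefficient * Y.point j + δ * Y.restValue j + δ * Y.x₂ j + δ * Y.x₃ j)
          ≈⟨ +-cong (+-congʳ (+-congʳ (+-congʳ (*-congʳ v≈ε+a)))) (+-congʳ (+-congʳ (+-congʳ (*-congʳ w≈ε+b)))) ⟩
        (ε + a) * X.point j + X.restValue j + X.x₂ j + X.x₃ j
          + ((ε + b) * Y.point j + δ * Y.restValue j + δ * Y.x₂ j + δ * Y.x₃ j)
          ≈⟨ solve 11 (λ ε a b v x c r w y d s →
                 (ε :+ a) :* v :+ x :+ c :+ r :+ ((ε :+ b) :* w :+ y :+ d :+ s)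
                 := ε :* (v :+ w) :+ (a :* v :+ x :+ c) :+ (r :+ (b :* w :+ y) :+ d :+ s)) refl
               ε a b (X.point j) (X.restValue j) (X.x₂ j) (X.x₃ j)
               (Y.point j) (δ * Y.restValue j) (δ * Y.x₂ j) (δ * Y.x₃ j) ⟩
        _ ∎
    }
    where
    0≤δ : 0# ≤ δ
    0≤δ = <⇒≤ 0<δ
    module X where
      open ConicDecomposition X public
      open StrictCone points public renaming (value to pointValue)
    module Y where
      open ConicDecomposition Y public
      open StrictCone points public renaming (value to pointValue)

  unflow : ConicDecomposition (V-P ⊕ V-F) (C-P ∪ V-P) (R-P ∪ V-F ∪ C-F ∪ R-F) z →
           PositivePostFlow (ConicDecomposition V-P C-P R-P) (ConicDecomposition V-F C-F R-F) z
  unflow Z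
    -- `V` and `W` are both strict and both have weight `Z.s₁`.
    with v , w , V , W , points≈ ← split-⊕⁺ (ConicDecomposition.points Z)
       | s₂ , s₁ , c₂ , c₁ , C₂ , C₁ , s≈ , closure≈ ← split-∪ (ConicDecomposition.closurePoints Z)
       | _ , _ , r , r′ , R , R′ , _ , rays≈ ← split-∪ (ConicDecomposition.rays Z)
    with t₁ , _ , d₁ , r″ , D₁ , R″ , _ , rays≈′ ← split-∪ R′
    with t₂ , _ , d₂ , d₃ , D₂ , D₃ , _ , rays≈″ ← split-∪ R″
    -- Here `δ` is the weight `Z.s₁ + t₁ + t₂` of everything over `V-F` and `C-F`. It is positive
    -- because `W` is strict.
    with u , 0<u , δ*u≈1 ← positiveInverse (pos+nonNeg (weight-pos (W ⁺⊹ D₁)) (weight-nonNeg D₂)) =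
    _ , _ , _ ,
    record
      -- Closure points coming from `V-P` return to the points; strictness is inherited from `V`.
      { points        = V ⁺⊹ C₁
      ; closurePoints = C₂
      ; rays          = R
      ; s₁+s₂≈1       = begin
          Z.s₁ + s₁ + s₂    ≈⟨ solve 3 (λ a b c → a :+ b :+ c := a :+ (c :+ b)) refl Z.s₁ s₁ s₂ ⟩
          Z.s₁ + (s₂ + s₁)  ≈⟨ +-congˡ s≈ ⟨
          Z.s₁ + Z.s₂       ≈⟨ Z.s₁+s₂≈1 ⟩
          1#                ∎
      ; value         = λ _ → refl
      } ,
    record
      { points        = scale⁺ 0<u (W ⁺⊹ D₁)
      ; closurePoints = scale (<⇒≤ 0<u) D₂
      ; rays          = scale (<⇒≤ 0<u) D₃
      ; s₁+s₂≈1       = trans (sym (distribˡ u _ _)) (trans (*-comm u _) δ*u≈1)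
      ; value         = λ _ → refl
      } ,
    pos+nonNeg (weight-pos (W ⁺⊹ D₁)) (weight-nonNeg D₂) ,
    λ j → begin
      _ ≈⟨ Z.value j ⟩
      _ ≈⟨ +-cong (+-cong (points≈ j) (closure≈ j))
             (trans (rays≈ j) (+-congˡ (trans (rays≈′ j) (+-congˡ (rays≈″ j))))) ⟩
      v j + w j + (c₂ j + c₁ j) + (r j + (d₁ j + (d₂ j + d₃ j)))
        -- The factor 1 is put before the part belonging to `F` so that it can be replaced by
        -- `δ * u`.
        ≈⟨ solve 8 (λ v w c₂ c₁ r d₁ d₂ d₃ → v :+ w :+ (c₂ :+ c₁) :+ (r :+ (d₁ :+ (d₂ :+ d₃)))
                      := v :+ c₁ :+ c₂ :+ r :+ con 1 :* (w :+ d₁ :+ d₂ :+ d₃)) refl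
             (v j) (w j) (c₂ j) (c₁ j) (r j) (d₁ j) (d₂ j) (d₃ j) ⟩
      v j + c₁ j + c₂ j + r j + 1# * (w j + d₁ j + d₂ j + d₃ j)
        ≈⟨ +-congˡ (*-congʳ δ*u≈1) ⟨
      v j + c₁ j + c₂ j + r j + (Z.s₁ + t₁ + t₂) * u * (w j + d₁ j + d₂ j + d₃ j)
        ≈⟨ +-congˡ (solve 5 (λ δ u y d₂ d₃ → δ :* u :* (y :+ d₂ :+ d₃)
                               := δ :* (u :* y :+ u :* d₂ :+ u :* d₃)) refl
                     (Z.s₁ + t₁ + t₂) u (w j + d₁ j) (d₂ j) (d₃ j)) ⟩
      _ ∎
    where module Z = ConicDecomposition Z

theorem2 : ∀ {c ℓ₁ ℓ₂ ℓ₃ ℓ} (reals : RealNumbers c ℓ₁ ℓ₂ ℓ₃) →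
    let open RealNumbers reals using () renaming (Carrier to ℝ)
        open Polyhedra reals
    in (n : ℕ) (P F V-P C-P R-P V-F C-F R-F : Pred (Vector ℝ n) ℓ) →
       IsConvexPolyhedron P →
       IsConvexPolyhedron F →
       IsGenerator V-P C-P R-P P →
       IsGenerator V-F C-F R-F F →
       IsGenerator (V-P ⊕ V-F) (C-P ∪ V-P) (R-P ∪ V-F ∪ C-F ∪ R-F) (PositivePostFlow P F)
theorem2 reals n P F V-P C-P R-P V-F C-F R-F _ _ genP genF = record
  { V-finite  = ⊕-enumeration GP.V-finite GF.V-finite
  ; C-finite  = ∪-enumeration GP.C-finite GP.V-finite
  ; R-finite  = ∪-enumeration GP.R-finite
                  (∪-enumeration GF.V-finite (∪-enumeration GF.C-finite GF.R-finite))
  -- The given enumerations of the new triple need not be those constructed above; `recompose` and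
  -- `decompose` accept any.
  ; generates = λ eV eC eR z → mk⇔
      (λ (x , y , δ , x∈P , y∈F , 0<δ , z≈) →
        recompose eV eC eR (flow (∈⇒conic genP x∈P) (∈⇒conic genF y∈F) 0<δ z≈))
      (λ Z → let (x , y , δ , X , Y , 0<δ , z≈) = unflow (decompose eV eC eR Z)
             in x , y , δ , conic⇒∈ genP X , conic⇒∈ genF Y , 0<δ , z≈)
  }
  where
  open Polyhedra reals
  open Cones reals
  open PostFlow reals
  module GP = IsGenerator genP
  module GF = IsGenerator genF
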